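{- Let $d\in\mathbb N_0$ and let $B_d=(b_{i,j})_{i,j=1}^{d+1}$ be the $(d+1)\times(d+1)$ matrix with $$b_{i,j}=\begin{cases}0 & \text{if } i>j,\\ a+b-1 & \text{if } i=j,\\ (2^{j-i}b+a)\binom{j-1}{i-1} & \text{if } i<j.\end{cases}$$ Then the following statements hold. (i) There exists a unique $(d+1)$-tuple $(b_0(d),b_1(d),\ldots,b_d(d))\in\mathbb R^{d+1}$ satisfying the matrix equation $$B_d\,(b_0(d),b_1(d),\ldots,b_d(d))^T=2\left(\binom{d}{0}2^d,\binom{d}{1}2^{d-1},\ldots,\binom{d}{d}2^0\right)^T.$$ (ii) Let $(b_0(d),b_1(d),\ldots,b_d(d))$ be the unique solution of the matrix equation in (i). Then the polynomials $F_{1,d}(x),G_{1,d}(x),H_{1,d}(x)$ defined by $$F_{1,d}(x)=\sum_{i=0}^{d}b_i(d)x^i,\qquad G_{1,d}(x)=-2(x+1)^d+b\sum_{i=0}^{d}b_i(d)(x+1)^i,$$ $$H_{1,d}(x)=2c_0+2^{d+1}c_1-(ac_1+bc_0)\sum_{i=0}^{d}b_i(d)-bc_1\sum_{i=0}^{d}2^ib_i(d)$$ ($H_{1,d}$ is a constant polynomial) satisfy, for all $n\in\mathbb N$, $$2\sum_{k=1}^{n}k^ds_{k-1}=F_{1,d}(n)s_{n+1}+G_{1,d}(n)s_n+H_{1,d}(n).$$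
   Context: $\mathbb N$ denotes the positive integers and $\mathbb N_0=\mathbb N\cup\{0\}$. Fix $a,b\in\mathbb N$ and $c_0,c_1\in\mathbb Z$ with $(c_0,c_1)\neq(0,0)$. The generalized Fibonacci sequence $(s_n)_{n\ge0}$ is defined by $s_0=c_0$, $s_1=c_1$, and $s_{n+1}=as_n+bs_{n-1}$ for all $n\in\mathbb N$. The number $b$, the matrix entries $b_{i,j}$ and the solution components $b_i(d)$ are distinct objects. -}

module Defs where

open import Algebra.Bundles using (CommutativeRing)
open import Algebra.Structures using (IsCommutativeRing)
open import Data.Fin.Base using (Fin; toℕ)
open import Data.Integer.Base as ℤ using (ℤ; +_; 0ℤ; 1ℤ)
open import Data.Nat.Base as ℕ using (ℕ; zero; suc; _∸_)
open import Data.Nat.Combinatorics using (_C_)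
import Data.Nat.Properties as ℕ
open import Data.Product.Base using (∃; _×_; _,_; proj₁; proj₂)
open import Data.Rational.Base as ℚ using (ℚ; 0ℚ; 1ℚ; ½; ∣_∣)
import Data.Rational.Literals as ℚ using (fromℤ)
import Data.Rational.Properties as ℚ
import Data.Rational.Solver as ℚSolver
open import Data.Vec.Functional using (Vector)
open import Level using (0ℓ)
open import Relation.Binary.Definitions using (tri<; tri≈; tri>)
open import Relation.Binary.PropositionalEquality
  using (_≡_; refl; sym; trans; cong; cong₂; subst; module ≡-Reasoning)

-- The real numbers, as Cauchy sequences of rationals; two sequences are
-- identified (_≈_) when their difference tends to zero.  The existential
-- quantifiers are Σ-types, so every sequence carries its modulus.

Close : ℚ → ℚ → ℚ → Set
Close ε p q = ∣ p ℚ.- q ∣ ℚ.< ε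

Cauchy : (ℕ → ℚ) → Set
Cauchy f = ∀ ε → 0ℚ ℚ.< ε →
  ∃ λ N → ∀ m n → N ℕ.≤ m → N ℕ.≤ n → Close ε (f m) (f n)

record ℝ : Set where
  constructor mkℝ
  field
    seq    : ℕ → ℚ
    cauchy : Cauchy seq

open ℝ public

infix 4 _≈_

-- A record rather than a function, so that x and y can be inferred
-- from x ≈ y.
record _≈_ (x y : ℝ) : Set where
  constructor mk≈
  field
    close : ∀ ε → 0ℚ ℚ.< ε →
      ∃ λ N → ∀ n → N ℕ.≤ n → Close ε (seq x n) (seq y n)

open _≈_ public

module ClosenessLemmas where

  open ℚSolver.+-*-Solver

  abstract
    close-refl : ∀ {ε} p → 0ℚ ℚ.< ε → Close ε p p
    close-refl {ε} p 0<ε =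
      subst (λ r → ∣ r ∣ ℚ.< ε) (sym (ℚ.+-inverseʳ p)) 0<ε

    close-sym : ∀ {ε} p q → Close ε p q → Close ε q p
    close-sym {ε} p q = subst (ℚ._< ε) (begin
      ∣ p ℚ.- q ∣            ≡⟨ ℚ.∣-p∣≡∣p∣ (p ℚ.- q) ⟨
      ∣ ℚ.- (p ℚ.- q) ∣      ≡⟨ cong ∣_∣ (solve 2 (λ p q → :- (p :- q) := q :- p) refl p q) ⟩
      ∣ q ℚ.- p ∣            ∎)
      where open ≡-Reasoning

    close-+ : ∀ {ε δ} p p′ q q′ → Close ε p p′ → Close δ q q′ →
              Close (ε ℚ.+ δ) (p ℚ.+ q) (p′ ℚ.+ q′)
    close-+ {ε} {δ} p p′ q q′ ε-close δ-close = begin-strict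
      ∣ (p ℚ.+ q) ℚ.- (p′ ℚ.+ q′) ∣        ≡⟨ cong ∣_∣ (solve 4 (λ p p′ q q′ →
        (p :+ q) :- (p′ :+ q′) := (p :- p′) :+ (q :- q′)) refl p p′ q q′) ⟩
      ∣ (p ℚ.- p′) ℚ.+ (q ℚ.- q′) ∣        ≤⟨ ℚ.∣p+q∣≤∣p∣+∣q∣ (p ℚ.- p′) (q ℚ.- q′) ⟩
      ∣ p ℚ.- p′ ∣ ℚ.+ ∣ q ℚ.- q′ ∣        <⟨ ℚ.+-mono-< ε-close δ-close ⟩
      ε ℚ.+ δ                              ∎
      where open ℚ.≤-Reasoning

    close-trans : ∀ {ε δ} p q r → Close ε p q → Close δ q r → Close (ε ℚ.+ δ) p r
    close-trans {ε} {δ} p q r ε-close δ-close =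
      subst (λ t → ∣ t ∣ ℚ.< ε ℚ.+ δ)
        (solve 3 (λ p q r → (p :+ q) :- (q :+ r) := p :- r) refl p q r)
        (close-+ p q q r ε-close δ-close)

    close-neg : ∀ {ε} p q → Close ε p q → Close ε (ℚ.- p) (ℚ.- q)
    close-neg {ε} p q pq = subst (λ t → ∣ t ∣ ℚ.< ε)
      (solve 2 (λ p q → q :- p := (:- p) :- (:- q)) refl p q) (close-sym p q pq)

    half : ∀ {ε} → 0ℚ ℚ.< ε → ∃ λ δ → 0ℚ ℚ.< δ × δ ℚ.+ δ ≡ ε
    half {ε} 0<ε = ½ ℚ.* ε
      , subst (ℚ._< ½ ℚ.* ε) (ℚ.*-zeroʳ ½) (ℚ.*-monoʳ-<-pos ½ 0<ε)
      , trans (sym (ℚ.*-distribʳ-+ ε ½ ½)) (ℚ.*-identityˡ ε)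

    scale-by : ∀ r K ε → 0ℚ ℚ.< r → K ℚ.* r ≡ 1ℚ → 0ℚ ℚ.< ε →
               ∃ λ δ → 0ℚ ℚ.< δ × K ℚ.* δ ≡ ε
    scale-by r K ε 0<r Kr≡1 0<ε = r ℚ.* ε
      , subst (ℚ._< r ℚ.* ε) (ℚ.*-zeroʳ r) (ℚ.*-monoʳ-<-pos r {{ℚ.positive 0<r}} 0<ε)
      , trans (sym (ℚ.*-assoc K r ε)) (trans (cong (ℚ._* ε) Kr≡1) (ℚ.*-identityˡ ε))

    reciprocal : ∀ K .{{_ : ℚ.Positive K}} → ∃ λ r → 0ℚ ℚ.< r × K ℚ.* r ≡ 1ℚ
    reciprocal K =
      (ℚ.1/ K) {{ℚ.pos⇒nonZero K}}
      , ℚ.positive⁻¹ ((ℚ.1/ K) {{ℚ.pos⇒nonZero K}}) {{ℚ.1/pos⇒pos K}}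
      , ℚ.*-inverseʳ K {{ℚ.pos⇒nonZero K}}

    scale : ∀ {K ε} → 0ℚ ℚ.< K → 0ℚ ℚ.< ε → ∃ λ δ → 0ℚ ℚ.< δ × K ℚ.* δ ≡ ε
    scale {K} {ε} 0<K 0<ε =
      let r , 0<r , Kr≡1 = reciprocal K {{ℚ.positive 0<K}}
      in scale-by r K ε 0<r Kr≡1 0<ε

    scaled-< : ∀ {K δ} r s → 0ℚ ℚ.< K → ∣ r ∣ ℚ.< K → ∣ s ∣ ℚ.< δ →
               ∣ r ℚ.* s ∣ ℚ.< K ℚ.* δ
    scaled-< {K} {δ} r s 0<K r<K s<δ = begin-strict
      ∣ r ℚ.* s ∣        ≡⟨ ℚ.∣p*q∣≡∣p∣*∣q∣ r s ⟩
      ∣ r ∣ ℚ.* ∣ s ∣    ≤⟨ ℚ.*-monoʳ-≤-nonNeg ∣ s ∣ {{ℚ.∣-∣-nonNeg s}} (ℚ.<⇒≤ r<K) ⟩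
      K ℚ.* ∣ s ∣        <⟨ ℚ.*-monoʳ-<-pos K {{ℚ.positive 0<K}} s<δ ⟩
      K ℚ.* δ            ∎
      where open ℚ.≤-Reasoning

    close-* : ∀ {K L ε δ} p p′ q q′ → 0ℚ ℚ.< K → 0ℚ ℚ.< L →
              ∣ p ∣ ℚ.< K → ∣ q′ ∣ ℚ.< L → Close ε q q′ → Close δ p p′ →
              Close (K ℚ.* ε ℚ.+ L ℚ.* δ) (p ℚ.* q) (p′ ℚ.* q′)
    close-* {K} {L} {ε} {δ} p p′ q q′ 0<K 0<L p<K q′<L qq′ pp′ = begin-strict
      ∣ p ℚ.* q ℚ.- p′ ℚ.* q′ ∣                             ≡⟨ cong ∣_∣ (solve 4 (λ p p′ q q′ →
        p :* q :- p′ :* q′ := p :* (q :- q′) :+ q′ :* (p :- p′)) refl p p′ q q′) ⟩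
      ∣ p ℚ.* (q ℚ.- q′) ℚ.+ q′ ℚ.* (p ℚ.- p′) ∣            ≤⟨ ℚ.∣p+q∣≤∣p∣+∣q∣ (p ℚ.* (q ℚ.- q′)) (q′ ℚ.* (p ℚ.- p′)) ⟩
      ∣ p ℚ.* (q ℚ.- q′) ∣ ℚ.+ ∣ q′ ℚ.* (p ℚ.- p′) ∣        <⟨ ℚ.+-mono-<
        (scaled-< p (q ℚ.- q′) 0<K p<K qq′) (scaled-< q′ (p ℚ.- p′) 0<L q′<L pp′) ⟩
      K ℚ.* ε ℚ.+ L ℚ.* δ                                   ∎
      where open ℚ.≤-Reasoning

    0<1 : 0ℚ ℚ.< 1ℚ
    0<1 = ℚ.positive⁻¹ 1ℚ

    split : ∀ {K L ε} → 0ℚ ℚ.< K → 0ℚ ℚ.< L → 0ℚ ℚ.< ε →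
            ∃ λ α → ∃ λ β → 0ℚ ℚ.< α × 0ℚ ℚ.< β × K ℚ.* α ℚ.+ L ℚ.* β ≡ ε
    split 0<K 0<L 0<ε =
      let δ , 0<δ , δ+δ≡ε = half 0<ε
          α , 0<α , Kα≡δ = scale 0<K 0<δ
          β , 0<β , Lβ≡δ = scale 0<L 0<δ
      in α , β , 0<α , 0<β , trans (cong₂ ℚ._+_ Kα≡δ Lβ≡δ) δ+δ≡ε

    +∣∣-pos : ∀ {ε} p → 0ℚ ℚ.< ε → 0ℚ ℚ.< ε ℚ.+ ∣ p ∣
    +∣∣-pos {ε} p 0<ε = subst (ℚ._< ε ℚ.+ ∣ p ∣) (ℚ.+-identityʳ 0ℚ)
      (ℚ.+-mono-<-≤ {0ℚ} {ε} {0ℚ} {∣ p ∣} 0<ε (ℚ.0≤∣p∣ p))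

    close⇒< : ∀ {ε} p q → Close ε p q → ∣ p ∣ ℚ.< ε ℚ.+ ∣ q ∣
    close⇒< {ε} p q pq = begin-strict
      ∣ p ∣                        ≡⟨ cong ∣_∣ (solve 2 (λ p q → p := (p :- q) :+ q) refl p q) ⟩
      ∣ (p ℚ.- q) ℚ.+ q ∣          ≤⟨ ℚ.∣p+q∣≤∣p∣+∣q∣ (p ℚ.- q) q ⟩
      ∣ p ℚ.- q ∣ ℚ.+ ∣ q ∣        <⟨ ℚ.+-monoˡ-< ∣ q ∣ pq ⟩
      ε ℚ.+ ∣ q ∣                  ∎
      where open ℚ.≤-Reasoning

    bounded : ∀ x → ∃ λ K → 0ℚ ℚ.< K × ∃ λ N → ∀ n → N ℕ.≤ n → ∣ seq x n ∣ ℚ.< K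
    bounded x =
      let N , x-close = cauchy x 1ℚ 0<1
      in 1ℚ ℚ.+ ∣ seq x N ∣ , +∣∣-pos {1ℚ} (seq x N) 0<1
         , N , λ n N≤n → close⇒< {1ℚ} (seq x n) (seq x N) (x-close n N N≤n ℕ.≤-refl)

    ⊔ˡ : ∀ m n {o} → m ℕ.⊔ n ℕ.≤ o → m ℕ.≤ o
    ⊔ˡ m n = ℕ.m⊔n≤o⇒m≤o m n

    ⊔ʳ : ∀ m n {o} → m ℕ.⊔ n ℕ.≤ o → n ℕ.≤ o
    ⊔ʳ m n = ℕ.m⊔n≤o⇒n≤o m n

open ClosenessLemmas

infixl 6 _+_
infixl 7 _*_
infix  8 -_

abstract
  +-cauchy : ∀ x y → Cauchy (λ n → seq x n ℚ.+ seq y n)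
  +-cauchy x y ε 0<ε =
    let δ , 0<δ , δ+δ≡ε = half 0<ε
        N , x-close = cauchy x δ 0<δ
        M , y-close = cauchy y δ 0<δ
    in N ℕ.⊔ M , λ m n ≤m ≤n →
      subst (λ t → Close t (seq x m ℚ.+ seq y m) (seq x n ℚ.+ seq y n)) δ+δ≡ε
        (close-+ (seq x m) (seq x n) (seq y m) (seq y n)
          (x-close m n (⊔ˡ N M ≤m) (⊔ˡ N M ≤n)) (y-close m n (⊔ʳ N M ≤m) (⊔ʳ N M ≤n)))

  neg-cauchy : ∀ x → Cauchy (λ n → ℚ.- seq x n)
  neg-cauchy x ε 0<ε =
    let N , x-close = cauchy x ε 0<ε
    in N , λ m n ≤m ≤n → close-neg (seq x m) (seq x n) (x-close m n ≤m ≤n)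

  *-cauchy : ∀ x y → Cauchy (λ n → seq x n ℚ.* seq y n)
  *-cauchy x y ε 0<ε =
    let K , 0<K , N₁ , x<K = bounded x
        L , 0<L , N₂ , y<L = bounded y
        α , β , 0<α , 0<β , Kα+Lβ≡ε = split 0<K 0<L 0<ε
        N₃ , y-close = cauchy y α 0<α
        N₄ , x-close = cauchy x β 0<β
        N₁₂ = N₁ ℕ.⊔ N₂
        N₃₄ = N₃ ℕ.⊔ N₄
    in N₁₂ ℕ.⊔ N₃₄ , λ m n ≤m ≤n →
      subst (λ t → Close t (seq x m ℚ.* seq y m) (seq x n ℚ.* seq y n)) Kα+Lβ≡ε
        (close-* (seq x m) (seq x n) (seq y m) (seq y n) 0<K 0<L
          (x<K m (⊔ˡ N₁ N₂ (⊔ˡ N₁₂ N₃₄ ≤m)))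
          (y<L n (⊔ʳ N₁ N₂ (⊔ˡ N₁₂ N₃₄ ≤n)))
          (y-close m n (⊔ˡ N₃ N₄ (⊔ʳ N₁₂ N₃₄ ≤m)) (⊔ˡ N₃ N₄ (⊔ʳ N₁₂ N₃₄ ≤n)))
          (x-close m n (⊔ʳ N₃ N₄ (⊔ʳ N₁₂ N₃₄ ≤m)) (⊔ʳ N₃ N₄ (⊔ʳ N₁₂ N₃₄ ≤n))))

_+_ : ℝ → ℝ → ℝ
seq    (x + y) n = seq x n ℚ.+ seq y n
cauchy (x + y)   = +-cauchy x y

-_ : ℝ → ℝ
seq    (- x) n = ℚ.- seq x n
cauchy (- x)   = neg-cauchy x

_*_ : ℝ → ℝ → ℝ
seq    (x * y) n = seq x n ℚ.* seq y n
cauchy (x * y)   = *-cauchy x y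

fromℚ : ℚ → ℝ
seq    (fromℚ q) _ = q
cauchy (fromℚ q) ε 0<ε = 0 , λ _ _ _ _ → close-refl q 0<ε

fromℤ : ℤ → ℝ
fromℤ z = fromℚ (ℚ.fromℤ z)

fromℕ : ℕ → ℝ
fromℕ n = fromℤ (+ n)

0ℝ 1ℝ : ℝ
0ℝ = fromℚ 0ℚ
1ℝ = fromℚ 1ℚ

abstract
  ≈-pointwise : ∀ {x y} → (∀ n → seq x n ≡ seq y n) → x ≈ y
  ≈-pointwise {x} {y} x≗y = mk≈ λ ε 0<ε → 0 , λ n _ →
    subst (Close ε (seq x n)) (x≗y n) (close-refl (seq x n) 0<ε)

  ≈-refl : ∀ {x} → x ≈ x
  ≈-refl = ≈-pointwise λ _ → refl

  ≈-sym : ∀ {x y} → x ≈ y → y ≈ x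
  ≈-sym {x} {y} x≈y = mk≈ λ ε 0<ε →
    let N , xy = close x≈y ε 0<ε
    in N , λ n ≤n → close-sym (seq x n) (seq y n) (xy n ≤n)

  ≈-trans : ∀ {x y z} → x ≈ y → y ≈ z → x ≈ z
  ≈-trans {x} {y} {z} x≈y y≈z = mk≈ λ ε 0<ε →
    let δ , 0<δ , δ+δ≡ε = half 0<ε
        N , xy = close x≈y δ 0<δ
        M , yz = close y≈z δ 0<δ
    in N ℕ.⊔ M , λ n ≤n →
      subst (λ t → Close t (seq x n) (seq z n)) δ+δ≡ε
        (close-trans (seq x n) (seq y n) (seq z n)
          (xy n (⊔ˡ N M ≤n)) (yz n (⊔ʳ N M ≤n)))

  +-cong : ∀ {x x′ y y′} → x ≈ x′ → y ≈ y′ → x + y ≈ x′ + y′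
  +-cong {x} {x′} {y} {y′} x≈x′ y≈y′ = mk≈ λ ε 0<ε →
    let δ , 0<δ , δ+δ≡ε = half 0<ε
        N , xx′ = close x≈x′ δ 0<δ
        M , yy′ = close y≈y′ δ 0<δ
    in N ℕ.⊔ M , λ n ≤n →
      subst (λ t → Close t (seq x n ℚ.+ seq y n) (seq x′ n ℚ.+ seq y′ n)) δ+δ≡ε
        (close-+ (seq x n) (seq x′ n) (seq y n) (seq y′ n)
          (xx′ n (⊔ˡ N M ≤n)) (yy′ n (⊔ʳ N M ≤n)))

  -‿cong : ∀ {x y} → x ≈ y → - x ≈ - y
  -‿cong {x} {y} x≈y = mk≈ λ ε 0<ε →
    let N , xy = close x≈y ε 0<ε
    in N , λ n ≤n → close-neg (seq x n) (seq y n) (xy n ≤n)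

  *-cong : ∀ {x x′ y y′} → x ≈ x′ → y ≈ y′ → x * y ≈ x′ * y′
  *-cong {x} {x′} {y} {y′} x≈x′ y≈y′ = mk≈ λ ε 0<ε →
    let K , 0<K , N₁ , x<K = bounded x
        L , 0<L , N₂ , y′<L = bounded y′
        α , β , 0<α , 0<β , Kα+Lβ≡ε = split 0<K 0<L 0<ε
        N₃ , yy′ = close y≈y′ α 0<α
        N₄ , xx′ = close x≈x′ β 0<β
        N₁₂ = N₁ ℕ.⊔ N₂
        N₃₄ = N₃ ℕ.⊔ N₄
    in N₁₂ ℕ.⊔ N₃₄ , λ n ≤n →
      subst (λ t → Close t (seq x n ℚ.* seq y n) (seq x′ n ℚ.* seq y′ n)) Kα+Lβ≡ε
        (close-* (seq x n) (seq x′ n) (seq y n) (seq y′ n) 0<K 0<L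
          (x<K n (⊔ˡ N₁ N₂ (⊔ˡ N₁₂ N₃₄ ≤n)))
          (y′<L n (⊔ʳ N₁ N₂ (⊔ˡ N₁₂ N₃₄ ≤n)))
          (yy′ n (⊔ˡ N₃ N₄ (⊔ʳ N₁₂ N₃₄ ≤n)))
          (xx′ n (⊔ʳ N₃ N₄ (⊔ʳ N₁₂ N₃₄ ≤n))))

+-*-isCommutativeRing : IsCommutativeRing _≈_ _+_ _*_ -_ 0ℝ 1ℝ
+-*-isCommutativeRing = record
  { isRing = record
    { +-isAbelianGroup = record
      { isGroup = record
        { isMonoid = record
          { isSemigroup = record
            { isMagma = record
              { isEquivalence = record
                { refl = ≈-refl ; sym = ≈-sym ; trans = ≈-trans }
              ; ∙-cong = +-cong
              }
            ; assoc = λ x y z → ≈-pointwise λ n → ℚ.+-assoc (seq x n) (seq y n) (seq z n)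
            }
          ; identity = (λ x → ≈-pointwise λ n → ℚ.+-identityˡ (seq x n))
                     , (λ x → ≈-pointwise λ n → ℚ.+-identityʳ (seq x n))
          }
        ; inverse = (λ x → ≈-pointwise λ n → ℚ.+-inverseˡ (seq x n))
                  , (λ x → ≈-pointwise λ n → ℚ.+-inverseʳ (seq x n))
        ; ⁻¹-cong = -‿cong
        }
      ; comm = λ x y → ≈-pointwise λ n → ℚ.+-comm (seq x n) (seq y n)
      }
    ; *-cong = *-cong
    ; *-assoc = λ x y z → ≈-pointwise λ n → ℚ.*-assoc (seq x n) (seq y n) (seq z n)
    ; *-identity = (λ x → ≈-pointwise λ n → ℚ.*-identityˡ (seq x n))
                 , (λ x → ≈-pointwise λ n → ℚ.*-identityʳ (seq x n))
    ; distrib = (λ x y z → ≈-pointwise λ n → ℚ.*-distribˡ-+ (seq x n) (seq y n) (seq z n))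
              , (λ x y z → ≈-pointwise λ n → ℚ.*-distribʳ-+ (seq x n) (seq y n) (seq z n))
    }
  ; *-comm = λ x y → ≈-pointwise λ n → ℚ.*-comm (seq x n) (seq y n)
  }

ℝ-commutativeRing : CommutativeRing 0ℓ 0ℓ
ℝ-commutativeRing = record { isCommutativeRing = +-*-isCommutativeRing }

open CommutativeRing ℝ-commutativeRing public
  using (_-_; setoid; semiring; commutativeSemiring)

open import Algebra.Properties.Semiring.Sum semiring public
  using (sum; sum-syntax)
open import Algebra.Properties.Semiring.Exp semiring public
  using (_^_)
open import Data.Vec.Functional.Relation.Binary.Equality.Setoid setoid public
  using (_≋_)

Matrix : ℕ → ℕ → Set
Matrix m n = Fin m → Fin n → ℝ

infixr 7 _*ᵥ_

_*ᵥ_ : ∀ {m n} → Matrix m n → Vector ℝ n → Vector ℝ m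
_*ᵥ_ {n = n} A v i = ∑[ j < n ] (A i j * v j)

fib : (a b : ℕ) (c₀ c₁ : ℤ) → ℕ → ℤ
fib a b c₀ c₁ zero          = c₀
fib a b c₀ c₁ (suc zero)    = c₁
fib a b c₀ c₁ (suc (suc n)) =
  + a ℤ.* fib a b c₀ c₁ (suc n) ℤ.+ + b ℤ.* fib a b c₀ c₁ n

-- Rows and columns are numbered from 0, so entry a b i j is the
-- coefficient usually written with indices i + 1 and j + 1, and its
-- binomial coefficient is (j choose i).
entry : (a b i j : ℕ) → ℤ
entry a b i j with ℕ.<-cmp i j
... | tri< _ _ _ = + ((2 ℕ.^ (j ∸ i) ℕ.* b ℕ.+ a) ℕ.* (j C i))
... | tri≈ _ _ _ = + a ℤ.+ + b ℤ.- 1ℤ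
... | tri> _ _ _ = 0ℤ

B : (a b d : ℕ) → Matrix (suc d) (suc d)
B a b d i j = fromℤ (entry a b (toℕ i) (toℕ j))

rhs : (d : ℕ) → Vector ℝ (suc d)
rhs d i = fromℕ 2 * (fromℕ (d C toℕ i) * fromℕ 2 ^ (d ∸ toℕ i))

IsSolution : (a b d : ℕ) → Vector ℝ (suc d) → Set
IsSolution a b d β = B a b d *ᵥ β ≋ rhs d

-- F, G and H are the polynomials in x, as functions on ℝ.  The vector β
-- stands for the solution of the matrix equation.

F : (d : ℕ) → Vector ℝ (suc d) → ℝ → ℝ
F d β x = ∑[ i < suc d ] (β i * x ^ toℕ i)

G : (b d : ℕ) → Vector ℝ (suc d) → ℝ → ℝ
G b d β x =
  - (fromℕ 2 * (x + 1ℝ) ^ d)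
  + fromℕ b * ∑[ i < suc d ] (β i * (x + 1ℝ) ^ toℕ i)

H : (a b : ℕ) (c₀ c₁ : ℤ) (d : ℕ) → Vector ℝ (suc d) → ℝ → ℝ
H a b c₀ c₁ d β _ =
  fromℕ 2 * fromℤ c₀ + fromℕ 2 ^ suc d * fromℤ c₁
  - (fromℕ a * fromℤ c₁ + fromℕ b * fromℤ c₀) * ∑[ i < suc d ] β i
  - fromℕ b * fromℤ c₁ * ∑[ i < suc d ] (fromℕ 2 ^ toℕ i * β i)

-- The summation index k runs from 0 to n - 1, so this is the sum of
-- k ^ d * s (k - 1) over 1 ≤ k ≤ n.
powerSum : (d : ℕ) (s : ℕ → ℤ) (n : ℕ) → ℝ
powerSum d s n = ∑[ k < n ] (fromℕ (suc (toℕ k)) ^ d * fromℤ (s (toℕ k)))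

{-# OPTIONS --safe #-}
module Submission where

-- Multiplying row i of the matrix equation by x ^ i and adding up the rows
-- turns it, by the binomial theorem, into the functional equation
--   b F(x + 2) + a F(x + 1) - F(x) = 2 (x + 2) ^ d.
-- With it, the difference of the right-hand sides of (ii) at n + 1 and n
-- is 2 (n + 1) ^ d sₙ, and the constant H makes both sides vanish at n = 0.
-- Part (i) is back substitution: a + b - 1 is a positive integer.

open import Defs
open import Algebra.Bundles using (CommutativeRing)
open import Algebra.Properties.CommutativeSemiring.Binomial commutativeSemiring
  using (binomialTerm) renaming (theorem to binomial-theorem)
import Algebra.Properties.Monoid.Mult as MonoidMult
open import Algebra.Properties.Semiring.Exp semiring using (^-congˡ)
open import Algebra.Properties.Semiring.Mult semiring using () renaming (_×_ to _·_)
open import Algebra.Properties.Semiring.Sum semiring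
  using (sum-cong-≋; sum-init-last; sum-replicate-zero; ∑-distrib-+; ∑-comm;
         *-distribˡ-sum; *-distribʳ-sum)
import Algebra.Solver.Ring as RingSolver
open import Algebra.Solver.Ring.AlmostCommutativeRing
  using (fromCommutativeRing; _-Raw-AlmostCommutative⟶_)
open import Data.Empty using (⊥-elim)
open import Data.Fin.Base as Fin using (Fin; zero; suc; toℕ)
open import Data.Fin.Properties using (toℕ<n; toℕ-inject₁; toℕ-fromℕ)
open import Data.Integer.Base as ℤ using (ℤ; +_; -[1+_]; 0ℤ; 1ℤ; -1ℤ)
import Data.Integer.Properties as ℤ
open import Data.Maybe.Base using (Maybe; map)
open import Data.Nat.Base as ℕ using (ℕ; zero; suc; NonZero; _∸_; s≤s; z≤n)
open import Data.Nat.Combinatorics using (_C_; nCn≡1; k>n⇒nCk≡0)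
import Data.Nat.Properties as ℕ
open import Data.Product using (∃; _×_; _,_; proj₁; proj₂; ∃!)
import Data.Rational.Base as ℚ
import Data.Rational.Literals as ℚ using (fromℤ)
import Data.Rational.Properties as ℚ
import Data.Rational.Unnormalised.Base as ℚᵘ
import Data.Rational.Unnormalised.Properties as ℚᵘ
open import Data.Vec.Functional using (Vector; tail; _∷_)
open import Function.Base using (_∘_)
open import Relation.Binary.Consequences using (dec⇒weaklyDec)
open import Relation.Binary.Definitions using (tri<; tri≈; tri>)
open import Relation.Binary.PropositionalEquality as ≡ using (_≡_; _≢_)
import Relation.Binary.Reasoning.Setoid setoid as ≈-Reasoning

open CommutativeRing ℝ-commutativeRing
  using (+-comm; +-congˡ; +-congʳ; *-congˡ; *-congʳ; *-assoc; *-comm; *-identityˡ; *-identityʳ;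
         +-identityʳ; zeroˡ; zeroʳ; reflexive; *-monoid)

-- Integers inside the reals, and a ring solver with integer constants

fromℤ-homo-+ : ∀ x y → fromℤ (x ℤ.+ y) ≈ fromℤ x + fromℤ y
-- Addition in `ℚ` normalises its result, so the identity is checked on unnormalised fractions,
-- where it is a cross-multiplication with all denominators 1.
fromℤ-homo-+ x y = ≈-pointwise λ _ → ℚ.toℚᵘ-injective (ℚᵘ.≃-trans
  (ℚᵘ.*≡* (≡.cong (ℤ._* 1ℤ) (≡.sym
    (≡.cong₂ ℤ._+_ (ℤ.*-identityʳ x) (ℤ.*-identityʳ y)))))
  (ℚᵘ.≃-sym (ℚ.toℚᵘ-homo-+ (ℚ.fromℤ x) (ℚ.fromℤ y))))

fromℤ-homo-* : ∀ x y → fromℤ (x ℤ.* y) ≈ fromℤ x * fromℤ y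
fromℤ-homo-* x y = ≈-pointwise λ _ → ℚ.toℚᵘ-injective
  (ℚᵘ.≃-sym (ℚ.toℚᵘ-homo-* (ℚ.fromℤ x) (ℚ.fromℤ y)))

fromℤ-homo-neg : ∀ x → fromℤ (ℤ.- x) ≈ - fromℤ x
fromℤ-homo-neg (+ zero)  = ≈-pointwise λ _ → ≡.refl
fromℤ-homo-neg (+ suc n) = ≈-pointwise λ _ → ≡.refl
fromℤ-homo-neg -[1+ n ]  = ≈-pointwise λ _ → ≡.refl

module ℝ-Solver where

  fromℤ-morphism :
    CommutativeRing.rawRing ℤ.+-*-commutativeRing
      -Raw-AlmostCommutative⟶ fromCommutativeRing ℝ-commutativeRing
  fromℤ-morphism = record
    { ⟦_⟧    = fromℤ
    ; +-homo = fromℤ-homo-+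
    ; *-homo = fromℤ-homo-*
    ; -‿homo = fromℤ-homo-neg
    ; 0-homo = ≈-refl
    ; 1-homo = ≈-refl
    }

  -- Equality of Cauchy reals has no decision procedure, so the solver compares its constants as
  -- integers. This suffices for it to combine numerals such as 2 and -1.
  fromℤ-≟ : ∀ x y → Maybe (fromℤ x ≈ fromℤ y)
  fromℤ-≟ x y = map (λ { ≡.refl → ≈-refl }) (dec⇒weaklyDec ℤ._≟_ x y)

  open RingSolver _ _ fromℤ-morphism fromℤ-≟ public

open ℝ-Solver using (solve; _:=_; _:+_; _:*_; _:-_; :-_; con)

fromℕ-homo-* : ∀ m n → fromℕ (m ℕ.* n) ≈ fromℕ m * fromℕ n
fromℕ-homo-* m n =
  ≈-trans (reflexive (≡.cong fromℤ (ℤ.pos-* m n))) (fromℤ-homo-* (+ m) (+ n))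

fromℕ-homo-^ : ∀ m n → fromℕ (m ℕ.^ n) ≈ fromℕ m ^ n
fromℕ-homo-^ m zero    = ≈-refl
fromℕ-homo-^ m (suc n) =
  ≈-trans (fromℕ-homo-* m (m ℕ.^ n)) (*-congˡ (fromℕ-homo-^ m n))

fromℕ-suc : ∀ n → fromℕ (suc n) ≈ fromℕ n + 1ℝ
fromℕ-suc n = ≈-trans (fromℤ-homo-+ 1ℤ (+ n)) (+-comm 1ℝ (fromℕ n))

-- The library's binomial theorem writes its coefficients as repeated addition, whereas the matrix
-- and `rhs` multiply by embedded naturals; this translates between the two.
·≈fromℕ* : ∀ n x → n · x ≈ fromℕ n * x
·≈fromℕ* zero    x = ≈-sym (zeroˡ x)
·≈fromℕ* (suc n) x = begin
  x + n · x            ≈⟨ +-congˡ (·≈fromℕ* n x) ⟩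
  x + fromℕ n * x      ≈⟨ solve 2 (λ n x → x :+ n :* x := (n :+ con 1ℤ) :* x) ≈-refl (fromℕ n) x ⟩
  (fromℕ n + 1ℝ) * x   ≈⟨ *-congʳ (fromℕ-suc n) ⟨
  fromℕ (suc n) * x    ∎
  where open ≈-Reasoning

1^n≈1 : ∀ n → 1ℝ ^ n ≈ 1ℝ
1^n≈1 zero    = ≈-refl
-- Powers are multiples in the multiplicative monoid, and a positive multiple of an idempotent
-- element is that element.
1^n≈1 (suc n) = MonoidMult.×-idem *-monoid (*-identityˡ 1ℝ) (suc n)

-- Finite sums and the binomial theorem

sum-zero : ∀ {n} (f : Vector ℝ n) → (∀ i → f i ≈ 0ℝ) → sum f ≈ 0ℝ
sum-zero {n} f f≈0 = ≈-trans (sum-cong-≋ f≈0) (sum-replicate-zero n)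

sum-truncate : ∀ {m n} → m ℕ.≤ n → (f : ℕ → ℝ) → (∀ k → m ℕ.≤ k → f k ≈ 0ℝ) →
               ∑[ i < n ] f (toℕ i) ≈ ∑[ i < m ] f (toℕ i)
sum-truncate {n = n} z≤n f f≈0 = sum-zero {n} (f ∘ toℕ) (λ i → f≈0 (toℕ i) z≤n)
sum-truncate (s≤s m≤n)   f f≈0 =
  +-congˡ (sum-truncate m≤n (f ∘ suc) (λ k m≤k → f≈0 (suc k) (s≤s m≤k)))

sum-linear : ∀ {n} p q r (f g h : Vector ℝ n) →
             ∑[ i < n ] (p * f i + q * g i + r * h i) ≈ p * sum f + q * sum g + r * sum h
sum-linear p q r f g h = begin
  sum (λ i → p * f i + q * g i + r * h i)
    ≈⟨ ∑-distrib-+ (λ i → p * f i + q * g i) (λ i → r * h i) ⟩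
  sum (λ i → p * f i + q * g i) + sum (λ i → r * h i)
    ≈⟨ +-congʳ (∑-distrib-+ (λ i → p * f i) (λ i → q * g i)) ⟩
  sum (λ i → p * f i) + sum (λ i → q * g i) + sum (λ i → r * h i)
    ≈⟨ +-cong (+-cong (*-distribˡ-sum p f) (*-distribˡ-sum q g)) (*-distribˡ-sum r h) ⟨
  p * sum f + q * sum g + r * sum h  ∎
  where open ≈-Reasoning

-- Terms with j < i vanish because j C i = 0, so the sum may run past j.
binomial-sum : ∀ x y {j d} → j ℕ.≤ d →
               ∑[ i < suc d ] (fromℕ (j C toℕ i) * y ^ (j ∸ toℕ i) * x ^ toℕ i) ≈ (x + y) ^ j
binomial-sum x y {j} {d} j≤d = begin
  ∑[ i < suc d ] term (toℕ i)          ≈⟨ sum-truncate (s≤s j≤d) term term≈0 ⟩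
  ∑[ i < suc j ] term (toℕ i)          ≈⟨ sum-cong-≋ {suc j} (λ i → ≈-trans
    (solve 3 (λ c u v → c :* v :* u := c :* (u :* v)) ≈-refl
      (fromℕ (j C toℕ i)) (x ^ toℕ i) (y ^ (j ∸ toℕ i)))
    (≈-sym (·≈fromℕ* (j C toℕ i) (x ^ toℕ i * y ^ (j ∸ toℕ i))))) ⟩
  ∑[ i < suc j ] binomialTerm x y j i  ≈⟨ binomial-theorem j x y ⟨
  (x + y) ^ j                          ∎
  where
  open ≈-Reasoning
  term : ℕ → ℝ
  term i = fromℕ (j C i) * y ^ (j ∸ i) * x ^ i
  term≈0 : ∀ i → j ℕ.< i → term i ≈ 0ℝ
  term≈0 i j<i = begin
    fromℕ (j C i) * y ^ (j ∸ i) * x ^ i  ≡⟨ ≡.cong (λ c → fromℕ c * y ^ (j ∸ i) * x ^ i) (k>n⇒nCk≡0 j<i) ⟩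
    0ℝ * y ^ (j ∸ i) * x ^ i             ≈⟨ *-congʳ (zeroˡ _) ⟩
    0ℝ * x ^ i                           ≈⟨ zeroˡ _ ⟩
    0ℝ                                   ∎

-- Unique solvability of triangular systems

UpperTriangular : ∀ {n} → Matrix n n → Set
UpperTriangular A = ∀ i j → j Fin.< i → A i j ≈ 0ℝ

-- Induction on the size: the lower rows do not involve the first unknown, so the minor without the
-- first row and column determines all the others. The first row then gives the first unknown, its
-- diagonal entry being invertible.
triangular-solvable : ∀ {n} (A : Matrix n n) → UpperTriangular A →
                      (∀ i → ∃ λ u → A i i * u ≈ 1ℝ) →
                      (r : Vector ℝ n) → ∃! _≋_ (λ v → A *ᵥ v ≋ r)
triangular-solvable {zero}  A upper unit r = (λ ()) , (λ ()) , λ _ ()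
triangular-solvable {suc n} A upper unit r = v₀ ∷ v , solution , unique
  where
  open ≈-Reasoning
  minor : Matrix n n
  minor i j = A (suc i) (suc j)

  row : Vector ℝ n → ℝ
  row w = ∑[ j < n ] (A zero (suc j) * w j)

  tail-unique : ∃! _≋_ (λ w → minor *ᵥ w ≋ tail r)
  tail-unique = triangular-solvable minor
    (λ i j j<i → upper (suc i) (suc j) (s≤s j<i)) (unit ∘ suc) (tail r)

  v = proj₁ tail-unique
  u = proj₁ (unit zero)
  -- The first row solved for its first unknown, with `u` the inverse of `A zero zero`.
  v₀ = u * (r zero - row v)

  lower-rows : ∀ w i → (A *ᵥ w) (suc i) ≈ (minor *ᵥ tail w) i
  lower-rows w i = begin
    A (suc i) zero * w zero + (minor *ᵥ tail w) i  ≈⟨ +-congʳ (*-congʳ (upper (suc i) zero (s≤s z≤n))) ⟩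
    0ℝ * w zero + (minor *ᵥ tail w) i              ≈⟨ solve 2 (λ x y → con 0ℤ :* x :+ y := y) ≈-refl
      (w zero) ((minor *ᵥ tail w) i) ⟩
    (minor *ᵥ tail w) i                            ∎

  solution : A *ᵥ (v₀ ∷ v) ≋ r
  solution zero = begin
    A zero zero * (u * (r zero - row v)) + row v  ≈⟨ solve 4 (λ a u r s →
      a :* (u :* (r :- s)) :+ s := a :* u :* (r :- s) :+ s) ≈-refl (A zero zero) u (r zero) (row v) ⟩
    A zero zero * u * (r zero - row v) + row v    ≈⟨ +-congʳ (*-congʳ (proj₂ (unit zero))) ⟩
    1ℝ * (r zero - row v) + row v                 ≈⟨ solve 2 (λ r s →
      con 1ℤ :* (r :- s) :+ s := r) ≈-refl (r zero) (row v) ⟩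
    r zero                                        ∎
  solution (suc i) = ≈-trans (lower-rows (v₀ ∷ v) i) (proj₁ (proj₂ tail-unique) i)

  unique : ∀ {w} → A *ᵥ w ≋ r → v₀ ∷ v ≋ w
  unique {w} Aw≋r = λ { zero → head-≈ ; (suc i) → tail-≋ i }
    where
    tail-≋ : v ≋ tail w
    -- By `lower-rows`, the tail of any solution solves the minor system, so the induction
    -- hypothesis applies to it.
    tail-≋ = proj₂ (proj₂ tail-unique)
      (λ i → ≈-trans (≈-sym (lower-rows w i)) (Aw≋r (suc i)))
    row-≈ : row v ≈ row (tail w)
    row-≈ = sum-cong-≋ {n} (λ j → *-congˡ (tail-≋ j))
    head-≈ : v₀ ≈ w zero
    head-≈ = begin
      u * (r zero - row v)
        -- Replacing `r zero` by the first row applied to `w` lets the off-diagonal parts cancel.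
        ≈⟨ *-congˡ (+-cong (≈-sym (Aw≋r zero)) (-‿cong row-≈)) ⟩
      u * (A zero zero * w zero + row (tail w) - row (tail w))
        ≈⟨ solve 4 (λ u a x s → u :* (a :* x :+ s :- s) := a :* u :* x) ≈-refl
             u (A zero zero) (w zero) (row (tail w)) ⟩
      A zero zero * u * w zero
        ≈⟨ *-congʳ (proj₂ (unit zero)) ⟩
      1ℝ * w zero
        ≈⟨ *-identityˡ (w zero) ⟩
      w zero  ∎

-- Entries of `B` and part (i)

fromℕ-suc-unit : ∀ n → ∃ λ u → fromℕ (suc n) * u ≈ 1ℝ
fromℕ-suc-unit n =
  fromℚ (ℚ.1/ ℚ.fromℤ (+ suc n)) , ≈-pointwise λ _ → ℚ.*-inverseʳ (ℚ.fromℤ (+ suc n))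

-- For positive arguments the integer computes to a natural number of the form `a ℕ.+ suc b`, which
-- is a successor and hence has a rational inverse.
diagonal-unit : ∀ a b .{{_ : NonZero a}} .{{_ : NonZero b}} →
                ∃ λ u → fromℤ (+ a ℤ.+ + b ℤ.- 1ℤ) * u ≈ 1ℝ
diagonal-unit (suc a) (suc b) =
  ≡.subst (λ n → ∃ λ u → fromℕ n * u ≈ 1ℝ) (≡.sym (ℕ.+-suc a b)) (fromℕ-suc-unit (a ℕ.+ b))

entry-diagonal : ∀ a b i → entry a b i i ≡ + a ℤ.+ + b ℤ.- 1ℤ
entry-diagonal a b i with ℕ.<-cmp i i
... | tri< i<i _ _ = ⊥-elim (ℕ.<-irrefl ≡.refl i<i)
... | tri≈ _ _ _   = ≡.refl
... | tri> _ _ i<i = ⊥-elim (ℕ.<-irrefl ≡.refl i<i)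

entry-below : ∀ a b {i j} → j ℕ.< i → entry a b i j ≡ 0ℤ
entry-below a b {i} {j} j<i with ℕ.<-cmp i j
... | tri< i<j _ _    = ⊥-elim (ℕ.<-asym i<j j<i)
... | tri≈ _ ≡.refl _ = ⊥-elim (ℕ.<-irrefl ≡.refl j<i)
... | tri> _ _ _      = ≡.refl

-- The three cases of the definition are one formula because
-- 0ℝ ^ (j ∸ i) * (j C i) is the Kronecker delta.
entry-uniform : ∀ a b i j →
  fromℤ (entry a b i j) ≈
    fromℕ (j C i) * (fromℕ b * fromℕ 2 ^ (j ∸ i) + fromℕ a * 1ℝ ^ (j ∸ i) - 0ℝ ^ (j ∸ i))
entry-uniform a b i j with ℕ.<-cmp i j
... | tri< i<j _ _ = above (j ∸ i) (j C i) (ℕ.m<n⇒0<n∸m i<j)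
  where
  open ≈-Reasoning
  -- With variables in place of `j ∸ i` and `j C i`, positivity allows `k` to be matched as a
  -- successor. Then `0ℝ ^ k` unfolds to a product with the factor `0ℝ`, and the delta term
  -- vanishes.
  above : ∀ k c → 0 ℕ.< k → fromℕ ((2 ℕ.^ k ℕ.* b ℕ.+ a) ℕ.* c) ≈
          fromℕ c * (fromℕ b * fromℕ 2 ^ k + fromℕ a * 1ℝ ^ k - 0ℝ ^ k)
  above k@(suc k-1) c _ = begin
    fromℕ ((2 ℕ.^ k ℕ.* b ℕ.+ a) ℕ.* c)
      ≈⟨ fromℕ-homo-* (2 ℕ.^ k ℕ.* b ℕ.+ a) c ⟩
    fromℕ (2 ℕ.^ k ℕ.* b ℕ.+ a) * fromℕ c
      ≈⟨ *-congʳ (fromℤ-homo-+ (+ (2 ℕ.^ k ℕ.* b)) (+ a)) ⟩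
    (fromℕ (2 ℕ.^ k ℕ.* b) + fromℕ a) * fromℕ c
      ≈⟨ *-congʳ (+-congʳ (fromℕ-homo-* (2 ℕ.^ k) b)) ⟩
    (fromℕ (2 ℕ.^ k) * fromℕ b + fromℕ a) * fromℕ c
      ≈⟨ *-congʳ (+-congʳ (*-congʳ (fromℕ-homo-^ 2 k))) ⟩
    (fromℕ 2 ^ k * fromℕ b + fromℕ a) * fromℕ c
      ≈⟨ solve 5 (λ a b c t o →
           (t :* b :+ a) :* c := c :* (b :* t :+ a :* con 1ℤ :- con 0ℤ :* o)) ≈-refl
           (fromℕ a) (fromℕ b) (fromℕ c) (fromℕ 2 ^ k) (0ℝ ^ k-1) ⟩
    fromℕ c * (fromℕ b * fromℕ 2 ^ k + fromℕ a * 1ℝ - 0ℝ ^ k)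
      ≈⟨ *-congˡ (+-congʳ (+-congˡ (*-congˡ (1^n≈1 k)))) ⟨
    fromℕ c * (fromℕ b * fromℕ 2 ^ k + fromℕ a * 1ℝ ^ k - 0ℝ ^ k)  ∎
... | tri≈ _ ≡.refl _ = diagonal (i ∸ i) (i C i) (ℕ.n∸n≡0 i) (nCn≡1 i)
  where
  open ≈-Reasoning
  diagonal : ∀ k c → k ≡ 0 → c ≡ 1 → fromℤ (+ a ℤ.+ + b ℤ.- 1ℤ) ≈
             fromℕ c * (fromℕ b * fromℕ 2 ^ k + fromℕ a * 1ℝ ^ k - 0ℝ ^ k)
  -- Here the exponent is 0, so `0ℝ ^ k` is `1ℝ` and supplies the -1 of the diagonal entry.
  diagonal _ _ ≡.refl ≡.refl = begin
    fromℤ (+ a ℤ.+ + b ℤ.- 1ℤ)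
      ≈⟨ fromℤ-homo-+ (+ a ℤ.+ + b) -1ℤ ⟩
    fromℤ (+ a ℤ.+ + b) + fromℤ -1ℤ
      ≈⟨ +-congʳ (fromℤ-homo-+ (+ a) (+ b)) ⟩
    fromℕ a + fromℕ b + fromℤ -1ℤ
      ≈⟨ solve 2 (λ a b → a :+ b :+ con -1ℤ :=
           con 1ℤ :* (b :* con 1ℤ :+ a :* con 1ℤ :- con 1ℤ)) ≈-refl (fromℕ a) (fromℕ b) ⟩
    fromℕ 1 * (fromℕ b * 1ℝ + fromℕ a * 1ℝ - 1ℝ)  ∎
-- Truncated subtraction makes `0ℝ ^ (j ∸ i)` equal to 1 here; the entry vanishes because the factor
-- `j C i` in front is 0.
... | tri> _ _ j<i = ≈-sym (≈-trans
  (*-congʳ (reflexive (≡.cong fromℕ (k>n⇒nCk≡0 j<i)))) (zeroˡ _))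

B-solvable : ∀ a b .{{_ : NonZero a}} .{{_ : NonZero b}} d → ∃! _≋_ (IsSolution a b d)
B-solvable a b d = triangular-solvable (B a b d)
  (λ i j j<i → reflexive (≡.cong fromℤ (entry-below a b j<i)))
  (λ i → ≡.subst (λ z → ∃ λ u → fromℤ z * u ≈ 1ℝ)
    (≡.sym (entry-diagonal a b (toℕ i))) (diagonal-unit a b))
  (rhs d)

-- Columns of `B` as polynomials

column-sum : ∀ a b d x (j : Fin (suc d)) →
  ∑[ i < suc d ] (B a b d i j * x ^ toℕ i) ≈
    fromℕ b * (x + 1ℝ + 1ℝ) ^ toℕ j + fromℕ a * (x + 1ℝ) ^ toℕ j + fromℤ -1ℤ * x ^ toℕ j
column-sum a b d x j = begin
  ∑[ i < suc d ] (B a b d i j * x ^ toℕ i)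
    ≈⟨ sum-cong-≋ {suc d} expand ⟩
  ∑[ i < suc d ] (fromℕ b * term (fromℕ 2) i + fromℕ a * term 1ℝ i + fromℤ -1ℤ * term 0ℝ i)
    ≈⟨ sum-linear (fromℕ b) (fromℕ a) (fromℤ -1ℤ) (term (fromℕ 2)) (term 1ℝ) (term 0ℝ) ⟩
  fromℕ b * sum (term (fromℕ 2)) + fromℕ a * sum (term 1ℝ) + fromℤ -1ℤ * sum (term 0ℝ)
    -- The binomial theorem is applied with second summand 2, 1 and 0. The last case encodes the
    -- delta term and returns the plain power of `x`.
    ≈⟨ +-cong (+-cong (*-congˡ (total (fromℕ 2))) (*-congˡ (total 1ℝ))) (*-congˡ (total 0ℝ)) ⟩
  fromℕ b * (x + fromℕ 2) ^ toℕ j + fromℕ a * (x + 1ℝ) ^ toℕ j + fromℤ -1ℤ * (x + 0ℝ) ^ toℕ j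
    -- The shift by 2 is written as two shifts by 1 because `G` at `x + 1ℝ` unfolds to an expression
    -- in `x + 1ℝ + 1ℝ`; in `telescope` the functional equation then matches literally.
    ≈⟨ +-cong (+-congʳ (*-congˡ (^-congˡ (toℕ j) x+2≈x+1+1))) (*-congˡ (^-congˡ (toℕ j) (+-identityʳ x))) ⟩
  fromℕ b * (x + 1ℝ + 1ℝ) ^ toℕ j + fromℕ a * (x + 1ℝ) ^ toℕ j + fromℤ -1ℤ * x ^ toℕ j  ∎
  where
  open ≈-Reasoning
  term : ℝ → Vector ℝ (suc d)
  term y i = fromℕ (toℕ j C toℕ i) * y ^ (toℕ j ∸ toℕ i) * x ^ toℕ i

  total : ∀ y → sum (term y) ≈ (x + y) ^ toℕ j
  total y = binomial-sum x y (ℕ.≤-pred (toℕ<n j))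

  expand : ∀ i → B a b d i j * x ^ toℕ i ≈
                 fromℕ b * term (fromℕ 2) i + fromℕ a * term 1ℝ i + fromℤ -1ℤ * term 0ℝ i
  expand i = ≈-trans (*-congʳ (entry-uniform a b (toℕ i) (toℕ j)))
    (solve 7 (λ a b c t u v w →
      c :* (b :* t :+ a :* u :- v) :* w :=
      b :* (c :* t :* w) :+ a :* (c :* u :* w) :+ con -1ℤ :* (c :* v :* w)) ≈-refl
      (fromℕ a) (fromℕ b) (fromℕ (toℕ j C toℕ i)) (fromℕ 2 ^ (toℕ j ∸ toℕ i))
      (1ℝ ^ (toℕ j ∸ toℕ i)) (0ℝ ^ (toℕ j ∸ toℕ i)) (x ^ toℕ i))

  x+2≈x+1+1 : x + fromℕ 2 ≈ x + 1ℝ + 1ℝ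
  x+2≈x+1+1 = solve 1 (λ x → x :+ con (+ 2) := x :+ con 1ℤ :+ con 1ℤ) ≈-refl x

-- The functional equation and the summation formula

F-cong : ∀ d β {x y} → x ≈ y → F d β x ≈ F d β y
F-cong d β x≈y = sum-cong-≋ {suc d} (λ i → *-congˡ {β i} (^-congˡ (toℕ i) x≈y))

G-cong : ∀ b d β {x y} → x ≈ y → G b d β x ≈ G b d β y
G-cong b d β x≈y = +-cong
  (-‿cong (*-congˡ (^-congˡ d (+-congʳ x≈y)))) (*-congˡ (F-cong d β (+-congʳ x≈y)))

-- `sum` unfolds at its first term, but raising `n` in `powerSum` adds a last one.
sum-suc : ∀ (f : ℕ → ℝ) n → ∑[ i < suc n ] f (toℕ i) ≈ ∑[ i < n ] f (toℕ i) + f n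
sum-suc f n = ≈-trans (sum-init-last {n} (f ∘ toℕ)) (+-cong
  (sum-cong-≋ {n} (λ i → reflexive (≡.cong f (toℕ-inject₁ i))))
  (reflexive (≡.cong f (toℕ-fromℕ n))))

module _ {a b d β} (solution : IsSolution a b d β) where

  open ≈-Reasoning

  F-equation : ∀ x → fromℕ b * F d β (x + 1ℝ + 1ℝ) + fromℕ a * F d β (x + 1ℝ) + fromℤ -1ℤ * F d β x
                     ≈ fromℕ 2 * (x + 1ℝ + 1ℝ) ^ d
  F-equation x = begin
    fromℕ b * F d β (x + 1ℝ + 1ℝ) + fromℕ a * F d β (x + 1ℝ) + fromℤ -1ℤ * F d β x
      ≈⟨ sum-linear {suc d} (fromℕ b) (fromℕ a) (fromℤ -1ℤ)
           (term (x + 1ℝ + 1ℝ)) (term (x + 1ℝ)) (term x) ⟨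
    ∑[ j < suc d ] (fromℕ b * (β j * (x + 1ℝ + 1ℝ) ^ toℕ j)
      + fromℕ a * (β j * (x + 1ℝ) ^ toℕ j) + fromℤ -1ℤ * (β j * x ^ toℕ j))
      ≈⟨ sum-cong-≋ {suc d} (λ j → solve 6 (λ a b c t u v →
           b :* (c :* t) :+ a :* (c :* u) :+ con -1ℤ :* (c :* v) :=
           c :* (b :* t :+ a :* u :+ con -1ℤ :* v)) ≈-refl
           (fromℕ a) (fromℕ b) (β j) ((x + 1ℝ + 1ℝ) ^ toℕ j) ((x + 1ℝ) ^ toℕ j) (x ^ toℕ j)) ⟩
    ∑[ j < suc d ] (β j * (fromℕ b * (x + 1ℝ + 1ℝ) ^ toℕ j
      + fromℕ a * (x + 1ℝ) ^ toℕ j + fromℤ -1ℤ * x ^ toℕ j))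
      ≈⟨ sum-cong-≋ {suc d} (λ j → *-congˡ {β j} (column-sum a b d x j)) ⟨
    ∑[ j < suc d ] (β j * ∑[ i < suc d ] (B a b d i j * x ^ toℕ i))
      ≈⟨ sum-cong-≋ {suc d} (λ j → *-distribˡ-sum {suc d} (β j) (λ i → B a b d i j * x ^ toℕ i)) ⟩
    ∑[ j < suc d ] ∑[ i < suc d ] (β j * (B a b d i j * x ^ toℕ i))
      -- Exchanging the summations passes from columns to rows: each inner sum becomes
      -- `(B a b d *ᵥ β) i` times `x ^ toℕ i`, and the matrix equation applies.
      ≈⟨ ∑-comm {suc d} {suc d} (λ j i → β j * (B a b d i j * x ^ toℕ i)) ⟩
    ∑[ i < suc d ] ∑[ j < suc d ] (β j * (B a b d i j * x ^ toℕ i))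
      ≈⟨ sum-cong-≋ {suc d} (λ i → sum-cong-≋ {suc d} (λ j →
           solve 3 (λ c e w → c :* (e :* w) := e :* c :* w) ≈-refl (β j) (B a b d i j) (x ^ toℕ i))) ⟩
    ∑[ i < suc d ] ∑[ j < suc d ] (B a b d i j * β j * x ^ toℕ i)
      ≈⟨ sum-cong-≋ {suc d} (λ i → *-distribʳ-sum {suc d} (x ^ toℕ i) (λ j → B a b d i j * β j)) ⟨
    ∑[ i < suc d ] ((B a b d *ᵥ β) i * x ^ toℕ i)
      ≈⟨ sum-cong-≋ {suc d} (λ i → *-congʳ {x ^ toℕ i} (solution i)) ⟩
    ∑[ i < suc d ] (rhs d i * x ^ toℕ i)
      ≈⟨ sum-cong-≋ {suc d} (λ i → *-assoc (fromℕ 2) (fromℕ (d C toℕ i) * fromℕ 2 ^ (d ∸ toℕ i)) (x ^ toℕ i)) ⟩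
    ∑[ i < suc d ] (fromℕ 2 * (fromℕ (d C toℕ i) * fromℕ 2 ^ (d ∸ toℕ i) * x ^ toℕ i))
      ≈⟨ *-distribˡ-sum {suc d} (fromℕ 2)
           (λ i → fromℕ (d C toℕ i) * fromℕ 2 ^ (d ∸ toℕ i) * x ^ toℕ i) ⟨
    fromℕ 2 * ∑[ i < suc d ] (fromℕ (d C toℕ i) * fromℕ 2 ^ (d ∸ toℕ i) * x ^ toℕ i)
      ≈⟨ *-congˡ (binomial-sum x (fromℕ 2) {d} {d} ℕ.≤-refl) ⟩
    fromℕ 2 * (x + fromℕ 2) ^ d
      ≈⟨ *-congˡ (^-congˡ d (solve 1 (λ x → x :+ con (+ 2) := x :+ con 1ℤ :+ con 1ℤ) ≈-refl x)) ⟩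
    fromℕ 2 * (x + 1ℝ + 1ℝ) ^ d  ∎
    where
    term : ℝ → Vector ℝ (suc d)
    term y j = β j * y ^ toℕ j

  -- Compare coefficients. That of `s₁` on the left is `a F(x + 1) + b F(x + 2) - 2 (x + 2) ^ d`,
  -- which is `F(x)` by `F-equation`. That of `s₀` is `b F(x + 1)`, which is `G(x) + 2 (x + 1) ^ d`
  -- by the definition of `G`. The constant `h` is carried along.
  telescope : ∀ x s₀ s₁ h →
    F d β (x + 1ℝ) * (fromℕ a * s₁ + fromℕ b * s₀) + G b d β (x + 1ℝ) * s₁ + h ≈
    F d β x * s₁ + G b d β x * s₀ + h + fromℕ 2 * ((x + 1ℝ) ^ d * s₀)
  telescope x s₀ s₁ h = begin
    f₁ * (fromℕ a * s₁ + fromℕ b * s₀) + (- (fromℕ 2 * p₂) + fromℕ b * f₂) * s₁ + h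
      ≈⟨ solve 10 (λ a b f₀ f₁ f₂ p₁ p₂ s₀ s₁ h →
           f₁ :* (a :* s₁ :+ b :* s₀) :+ (:- (con (+ 2) :* p₂) :+ b :* f₂) :* s₁ :+ h :=
           (b :* f₂ :+ a :* f₁ :+ con -1ℤ :* f₀) :* s₁ :+ (f₀ :* s₁ :+ (:- (con (+ 2) :* p₁) :+ b :* f₁) :* s₀
             :+ h :+ con (+ 2) :* (p₁ :* s₀)) :- con (+ 2) :* p₂ :* s₁) ≈-refl
           (fromℕ a) (fromℕ b) f₀ f₁ f₂ p₁ p₂ s₀ s₁ h ⟩
    (fromℕ b * f₂ + fromℕ a * f₁ + fromℤ -1ℤ * f₀) * s₁ + y - fromℕ 2 * p₂ * s₁
      ≈⟨ +-congʳ (+-congʳ (*-congʳ (F-equation x))) ⟩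
    fromℕ 2 * p₂ * s₁ + y - fromℕ 2 * p₂ * s₁
      ≈⟨ solve 2 (λ u y → u :+ y :- u := y) ≈-refl (fromℕ 2 * p₂ * s₁) y ⟩
    y  ∎
    where
    f₀ = F d β x
    f₁ = F d β (x + 1ℝ)
    f₂ = F d β (x + 1ℝ + 1ℝ)
    p₁ = (x + 1ℝ) ^ d
    p₂ = (x + 1ℝ + 1ℝ) ^ d
    y = f₀ * s₁ + G b d β x * s₀ + h + fromℕ 2 * (p₁ * s₀)

  -- The two sums in `H` are the values of `F` at 1 and 2. After this substitution the terms with
  -- `c₀` cancel directly, and those with `c₁` cancel by `F-equation` at 0.
  initial : ∀ c₀ c₁ → F d β 0ℝ * fromℤ c₁ + G b d β 0ℝ * fromℤ c₀ + H a b c₀ c₁ d β 0ℝ ≈ 0ℝ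
  initial c₀ c₁ = begin
    F d β 0ℝ * fromℤ c₁ + G b d β 0ℝ * fromℤ c₀ + H a b c₀ c₁ d β 0ℝ
      ≈⟨ +-cong (+-congˡ (*-congʳ G₀)) H₀ ⟩
    f₀ * fromℤ c₁ + (- (fromℕ 2 * 1ℝ) + fromℕ b * f₁) * fromℤ c₀
      + (fromℕ 2 * fromℤ c₀ + fromℕ 2 * p₂ * fromℤ c₁
         - (fromℕ a * fromℤ c₁ + fromℕ b * fromℤ c₀) * f₁ - fromℕ b * fromℤ c₁ * f₂)
      ≈⟨ solve 8 (λ a b f₀ f₁ f₂ p₂ c₀ c₁ →
           f₀ :* c₁ :+ (:- (con (+ 2) :* con 1ℤ) :+ b :* f₁) :* c₀
             :+ (con (+ 2) :* c₀ :+ con (+ 2) :* p₂ :* c₁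
               :- (a :* c₁ :+ b :* c₀) :* f₁ :- b :* c₁ :* f₂) :=
           con (+ 2) :* p₂ :* c₁ :- (b :* f₂ :+ a :* f₁ :+ con -1ℤ :* f₀) :* c₁) ≈-refl
           (fromℕ a) (fromℕ b) f₀ f₁ f₂ p₂ (fromℤ c₀) (fromℤ c₁) ⟩
    fromℕ 2 * p₂ * fromℤ c₁ - (fromℕ b * f₂ + fromℕ a * f₁ + fromℤ -1ℤ * f₀) * fromℤ c₁
      ≈⟨ +-congˡ (-‿cong (*-congʳ (F-equation 0ℝ))) ⟩
    fromℕ 2 * p₂ * fromℤ c₁ - fromℕ 2 * p₂ * fromℤ c₁
      ≈⟨ solve 1 (λ u → u :- u := con 0ℤ) ≈-refl (fromℕ 2 * p₂ * fromℤ c₁) ⟩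
    0ℝ  ∎
    where
    f₀ = F d β 0ℝ
    f₁ = F d β (0ℝ + 1ℝ)
    f₂ = F d β (0ℝ + 1ℝ + 1ℝ)
    p₂ = (0ℝ + 1ℝ + 1ℝ) ^ d

    0+1 : 0ℝ + 1ℝ ≈ 1ℝ
    0+1 = solve 0 (con 0ℤ :+ con 1ℤ := con 1ℤ) ≈-refl

    0+1+1 : fromℕ 2 ≈ 0ℝ + 1ℝ + 1ℝ
    0+1+1 = solve 0 (con (+ 2) := con 0ℤ :+ con 1ℤ :+ con 1ℤ) ≈-refl

    G₀ : G b d β 0ℝ ≈ - (fromℕ 2 * 1ℝ) + fromℕ b * f₁
    G₀ = +-congʳ (-‿cong (*-congˡ (≈-trans (^-congˡ d 0+1) (1^n≈1 d))))

    sum≈f₁ : ∑[ i < suc d ] β i ≈ f₁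
    sum≈f₁ = ≈-sym (sum-cong-≋ {suc d} (λ i → ≈-trans
      (*-congˡ (≈-trans (^-congˡ (toℕ i) 0+1) (1^n≈1 (toℕ i)))) (*-identityʳ (β i))))

    sum≈f₂ : ∑[ i < suc d ] (fromℕ 2 ^ toℕ i * β i) ≈ f₂
    sum≈f₂ = sum-cong-≋ {suc d} (λ i → ≈-trans
      (*-comm _ (β i)) (*-congˡ (^-congˡ (toℕ i) 0+1+1)))

    H₀ : H a b c₀ c₁ d β 0ℝ ≈
         fromℕ 2 * fromℤ c₀ + fromℕ 2 * p₂ * fromℤ c₁
         - (fromℕ a * fromℤ c₁ + fromℕ b * fromℤ c₀) * f₁ - fromℕ b * fromℤ c₁ * f₂
    H₀ = +-cong
      (+-cong (+-congˡ (*-congʳ (*-congˡ (^-congˡ d 0+1+1)))) (-‿cong (*-congˡ sum≈f₁)))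
      (-‿cong (*-congˡ sum≈f₂))

  -- Induction starting from the empty sum at `n = 0`, which is `initial`; each further term is
  -- absorbed by `telescope`, read from right to left.
  power-sum-formula : ∀ c₀ c₁ n →
    fromℕ 2 * powerSum d (fib a b c₀ c₁) n
      ≈ F d β (fromℕ n) * fromℤ (fib a b c₀ c₁ (suc n))
        + G b d β (fromℕ n) * fromℤ (fib a b c₀ c₁ n)
        + H a b c₀ c₁ d β (fromℕ n)
  power-sum-formula c₀ c₁ zero = ≈-trans (zeroʳ (fromℕ 2)) (≈-sym (initial c₀ c₁))
  power-sum-formula c₀ c₁ (suc n) = begin
    fromℕ 2 * powerSum d s (suc n)
      ≈⟨ *-congˡ (sum-suc (λ k → fromℕ (suc k) ^ d * fromℤ (s k)) n) ⟩
    fromℕ 2 * (powerSum d s n + fromℕ (suc n) ^ d * s₀)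
      ≈⟨ solve 2 (λ p q → con (+ 2) :* (p :+ q) := con (+ 2) :* p :+ con (+ 2) :* q) ≈-refl
           (powerSum d s n) (fromℕ (suc n) ^ d * s₀) ⟩
    fromℕ 2 * powerSum d s n + fromℕ 2 * (fromℕ (suc n) ^ d * s₀)
      ≈⟨ +-cong (power-sum-formula c₀ c₁ n) (*-congˡ (*-congʳ (^-congˡ d (fromℕ-suc n)))) ⟩
    F d β x * s₁ + G b d β x * s₀ + h + fromℕ 2 * ((x + 1ℝ) ^ d * s₀)
      ≈⟨ telescope x s₀ s₁ h ⟨
    F d β (x + 1ℝ) * (fromℕ a * s₁ + fromℕ b * s₀) + G b d β (x + 1ℝ) * s₁ + h
      ≈⟨ +-congʳ (+-cong (*-cong (F-cong d β (fromℕ-suc n)) recurrence)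
           (*-congʳ (G-cong b d β (fromℕ-suc n)))) ⟨
    F d β (fromℕ (suc n)) * fromℤ (s (suc (suc n))) + G b d β (fromℕ (suc n)) * s₁ + h  ∎
    where
    s = fib a b c₀ c₁
    s₀ = fromℤ (s n)
    s₁ = fromℤ (s (suc n))
    x = fromℕ n
    -- `H` is constant in its last argument, so its values at `fromℕ n` and `fromℕ (suc n)` agree by
    -- computation and `h` stands for both.
    h = H a b c₀ c₁ d β x

    recurrence : fromℤ (s (suc (suc n))) ≈ fromℕ a * s₁ + fromℕ b * s₀
    recurrence = ≈-trans (fromℤ-homo-+ (+ a ℤ.* s (suc n)) (+ b ℤ.* s n))
      (+-cong (fromℤ-homo-* (+ a) (s (suc n))) (fromℤ-homo-* (+ b) (s n)))

theorem2p5 : (a b : ℕ) .{{_ : NonZero a}} .{{_ : NonZero b}} (c₀ c₁ : ℤ) →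
    (c₀ , c₁) ≢ (0ℤ , 0ℤ) → (d : ℕ) →
    ∃! _≋_ (IsSolution a b d)
    × ((β : Vector ℝ (suc d)) → IsSolution a b d β →
    (n : ℕ) .{{_ : NonZero n}} →
    fromℕ 2 * powerSum d (fib a b c₀ c₁) n
    ≈ F d β (fromℕ n) * fromℤ (fib a b c₀ c₁ (suc n))
    + G b d β (fromℕ n) * fromℤ (fib a b c₀ c₁ n)
    + H a b c₀ c₁ d β (fromℕ n))
theorem2p5 a b c₀ c₁ _ d =
  B-solvable a b d , λ β solution n → power-sum-formula {a} {b} {d} {β} solution c₀ c₁ n
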